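{- For every integer $n\ge 1$, every finite characterisation of $\Box^n p$ with respect to $\mathbb{C}(\mathcal{F}_{\mathrm{all}},\mathcal{L}_{\Box,\Diamond,\wedge,\vee}[\{p\}])$ has at least $\mathrm{tower}(n,2)$ many positive examples. Dually, every finite characterisation of $\Diamond^n p$ with respect to $\mathbb{C}(\mathcal{F}_{\mathrm{all}},\mathcal{L}_{\Box,\Diamond,\wedge,\vee}[\{p\}])$ has at least $\mathrm{tower}(n,2)$ many negative examples.
   Context: $\mathrm{tower}(1,m):=m$ and $\mathrm{tower}(n+1,m):=2^{\mathrm{tower}(n,m)}$. $\Box^n$ and $\Diamond^n$ denote $n$-fold iteration. $\mathcal{L}_{\Box,\Diamond,\wedge,\vee}[\{p\}]$ is the set of modal formulas generated from the single propositional variable $p$ using only $\Box,\Diamond$ and binary $\wedge,\vee$ (no $\top$, $\bot$, negation). A Kripke model over $\{p\}$ is $M=(dom(M),R,v)$ with $R\subseteq dom(M)^2$ and $v:dom(M)\to\mathcal{P}(\{p\})$; a pointed model is $(M,s)$ with $s\in dom(M)$; satisfaction is standard Kripke semantics. $\mathcal{F}_{\mathrm{all}}$ is the class of all frames, so the examples of the concept class $\mathbb{C}(\mathcal{F}_{\mathrm{all}},\mathcal{L}_{\Box,\Diamond,\wedge,\vee}[\{p\}])$ are all pointed models over $\{p\}$, its concepts are the formulas in $\mathcal{L}_{\Box,\Diamond,\wedge,\vee}[\{p\}]$, and $(M,s)$ is a positive example for $\varphi$ if $M,s\models\varphi$ and a negative one otherwise. A formula $\varphi$ fits a pair $(E^+,E^-)$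 of finite sets of pointed models if $\varphi$ is true at every element of $E^+$ and false at every element of $E^-$. A finite characterisation of $\varphi$ is a pair $(E^+,E^-)$ of finite sets of pointed models such that $\varphi$ fits $(E^+,E^-)$ and every $\psi\in\mathcal{L}_{\Box,\Diamond,\wedge,\vee}[\{p\}]$ that fits $(E^+,E^-)$ is equivalent to $\varphi$ (true at the same pointed models). Its positive examples are the elements of $E^+$ and its negative examples the elements of $E^-$. -}

module Defs where

open import Data.Fin.Base using (Fin)
open import Data.List.Base using (List)
open import Data.List.Membership.Propositional using (_∈_)
open import Data.List.Relation.Unary.All using (All)
open import Data.Nat.Base using (ℕ; zero; suc; _^_)
open import Data.Nat.GeneralisedArithmetic using (fold)
open import Data.Product.Base using (_×_; ∃-syntax)
open import Data.Sum.Base using (_⊎_)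
open import Function.Bundles using (_⇔_)
open import Function.Definitions using (Injective)
open import Level using (Level) renaming (suc to lsuc)
open import Relation.Binary.Core using (Rel)
open import Relation.Binary.PropositionalEquality.Core using (_≡_)
open import Relation.Nullary.Negation.Core using (¬_)
open import Relation.Unary using (Pred)

-- Only n ≥ 1 is meaningful; the value at n = 0 is arbitrary.
tower : ℕ → ℕ → ℕ
tower zero            m = m
tower (suc zero)      m = m
tower (suc n@(suc _)) m = 2 ^ tower n m

data Var : Set where
  p : Var

infixr 8 □_ ◇_
infixr 7 _∧_
infixr 6 _∨_

data Formula : Set where
  var     : Var → Formula
  □_ ◇_   : Formula → Formula
  _∧_ _∨_ : Formula → Formula → Formula

□^ ◇^ : ℕ → Formula → Formula
□^ n φ = fold φ □_ n
◇^ n φ = fold φ ◇_ n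

record Model (ℓ : Level) : Set (lsuc ℓ) where
  field
    dom : Set ℓ
    R   : Rel dom ℓ
    v   : dom → Pred Var ℓ

record PointedModel (ℓ : Level) : Set (lsuc ℓ) where
  constructor _at_
  field
    model : Model ℓ
    point : Model.dom model

infix 4 _,_⊨_ _⊩_

-- These are the classical Kripke clauses only when the metalogic is classical:
-- models may be infinite and satisfaction is not decidable in general, so
-- results meant classically take ExcludedMiddle ℓ as a hypothesis.
_,_⊨_ : ∀ {ℓ} (M : Model ℓ) → Model.dom M → Formula → Set ℓ
M , s ⊨ var x = Model.v M s x
M , s ⊨ □ φ   = ∀ t → Model.R M s t → M , t ⊨ φ
M , s ⊨ ◇ φ   = ∃[ t ] (Model.R M s t × M , t ⊨ φ)
M , s ⊨ φ ∧ ψ = (M , s ⊨ φ) × (M , s ⊨ ψ)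
M , s ⊨ φ ∨ ψ = (M , s ⊨ φ) ⊎ (M , s ⊨ ψ)

_⊩_ : ∀ {ℓ} → PointedModel ℓ → Formula → Set ℓ
(M at s) ⊩ φ = M , s ⊨ φ

-- Finite sets of examples are given by lists enumerating them, so order and
-- repetitions carry no meaning; see HasAtLeast for how elements are counted.
-- The models themselves may be infinite.
Fits : ∀ {ℓ} → Formula → List (PointedModel ℓ) → List (PointedModel ℓ) → Set (lsuc ℓ)
Fits φ E⁺ E⁻ = All (_⊩ φ) E⁺ × All (λ e → ¬ (e ⊩ φ)) E⁻

Equivalent : (ℓ : Level) → Formula → Formula → Set (lsuc ℓ)
Equivalent ℓ φ ψ = (e : PointedModel ℓ) → (e ⊩ φ) ⇔ (e ⊩ ψ)

record FiniteCharacterisation {ℓ} (φ : Formula) (E⁺ E⁻ : List (PointedModel ℓ))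
                              : Set (lsuc ℓ) where
  field
    fits   : Fits φ E⁺ E⁻
    unique : ∀ ψ → Fits ψ E⁺ E⁻ → Equivalent ℓ ψ φ

-- At least k pairwise distinct members: unlike the length of the list, this
-- does not count repetitions.
HasAtLeast : ∀ {a} {A : Set a} → ℕ → List A → Set a
HasAtLeast {A = A} k xs =
  ∃[ f ] (Injective {A = Fin k} {B = A} _≡_ _≡_ f × (∀ i → f i ∈ xs))

{-# OPTIONS --safe #-}

-- Say that formulas ψ₁, …, ψₖ lie strictly below φ and that ψᵢ ∨ ψⱼ is
-- equivalent to φ whenever i ≠ j.  No ψᵢ can fit a characterisation of φ, so
-- each ψᵢ fails at some positive example, and no positive example refutes two
-- of them: there are at least k positive examples.
--
-- From such a family below φ one gets a family of size 2ᵏ below □ φ.  A point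
-- satisfying □ φ has a type, the set of those i for which ψᵢ fails at some
-- successor, and for each T ⊆ {1, …, k} the formula
--   □ φ ∧ (⋁_{i ∈ T} □ ψᵢ ∨ ◇ (φ ∧ ⋀_{i ∈ T} ψᵢ))
-- fails only at points of type T.  Iterating from the one-element family
-- {p ∧ ◇ p} below p gives the tower.
--
-- The statement for ◇ⁿ p follows by complementing valuations.
module Submission where

open import Axiom.ExcludedMiddle using (ExcludedMiddle)
open import Data.Empty using (⊥)
open import Data.Fin.Base using (Fin; zero; suc; combine; finToFun; funToFin)
open import Data.Fin.Properties using (_≟_; funToFin-finToFin)
open import Data.List.Base using (List; []; _∷_; allFin; filter; foldr; map)
open import Data.List.Membership.DecPropositional using (_∈?_)
open import Data.List.Membership.Propositional using (_∈_; find; lose)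
open import Data.List.Membership.Propositional.Properties
  using (∈-allFin; ∈-filter⁺; ∈-filter⁻; ∈-map⁻)
open import Data.List.Relation.Unary.All as All using (All; []; _∷_)
import Data.List.Relation.Unary.All.Properties as All
open import Data.List.Relation.Unary.Any using (Any; here; there)
open import Data.Maybe.Base using (Maybe; nothing; just)
open import Data.Nat.Base using (ℕ; zero; suc; _≥_; _^_)
open import Data.Product.Base using (_×_; _,_; ∃; ∃-syntax; proj₁; proj₂)
open import Data.Sum.Base using (_⊎_; inj₁; inj₂)
open import Data.Unit.Polymorphic.Base using (⊤)
open import Function.Base using (_∘_)
open import Function.Bundles using (_⇔_; mk⇔; module Equivalence)
open import Level using (Level) renaming (suc to lsuc)
open import Relation.Binary.Core using (Rel)
open import Relation.Binary.PropositionalEquality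
  using (_≡_; _≗_; refl; sym; trans; cong; cong₂; subst)
open import Relation.Nullary.Decidable.Core using (decidable-stable)
open import Relation.Nullary.Negation.Core using (¬_)
open import Defs

open Equivalence using (to; from)

-- Finite conjunctions and disjunctions.

-- Lists are folded onto a formula χ since the language has no ⊤ and no ⊥.
⋀ ⋁ : ∀ {I : Set} → Formula → (I → Formula) → List I → Formula
⋀ χ ψ = foldr (λ i → ψ i ∧_) χ
⋁ χ ψ = foldr (λ i → ψ i ∨_) χ

module _ {ℓ} (e : PointedModel ℓ) {I : Set} {χ : Formula} {ψ : I → Formula} where

  ⋀⁺ : ∀ {is} → e ⊩ χ → All (λ i → e ⊩ ψ i) is → e ⊩ ⋀ χ ψ is
  ⋀⁺ h []       = h
  ⋀⁺ h (k ∷ ks) = k , ⋀⁺ h ks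

  ⋀⁻ : ∀ is → e ⊩ ⋀ χ ψ is → All (λ i → e ⊩ ψ i) is
  ⋀⁻ []       h        = []
  ⋀⁻ (_ ∷ is) (k , ks) = k ∷ ⋀⁻ is ks

  ⋁⁺ : ∀ is → Any (λ i → e ⊩ ψ i) is ⊎ e ⊩ χ → e ⊩ ⋁ χ ψ is
  ⋁⁺ []       (inj₂ h)         = h
  ⋁⁺ (_ ∷ is) (inj₁ (here k))  = inj₁ k
  ⋁⁺ (_ ∷ is) (inj₁ (there k)) = inj₂ (⋁⁺ is (inj₁ k))
  ⋁⁺ (_ ∷ is) (inj₂ h)         = inj₂ (⋁⁺ is (inj₂ h))

  ⋁⁻ : ∀ is → e ⊩ ⋁ χ ψ is → Any (λ i → e ⊩ ψ i) is ⊎ e ⊩ χ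
  ⋁⁻ []       h        = inj₂ h
  ⋁⁻ (_ ∷ is) (inj₁ k) = inj₁ (here k)
  ⋁⁻ (_ ∷ is) (inj₂ k) with ⋁⁻ is k
  ... | inj₁ a = inj₁ (there a)
  ... | inj₂ h = inj₂ h

-- Subsets of a finite set coded as numbers.

funToFin-cong : ∀ {m n} {f g : Fin m → Fin n} → f ≗ g → funToFin f ≡ funToFin g
funToFin-cong {zero}  eq = refl
funToFin-cong {suc m} eq = cong₂ combine (eq zero) (funToFin-cong (eq ∘ suc))

Fin2-ext : {x y : Fin 2} → (x ≡ suc zero → y ≡ suc zero) →
           (y ≡ suc zero → x ≡ suc zero) → x ≡ y
Fin2-ext {zero}     {zero}     f g = refl
Fin2-ext {zero}     {suc zero} f g = g refl
Fin2-ext {suc zero} {y}        f g = sym (f refl)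

module _ (k : ℕ) where

  private
    bit : Fin (2 ^ k) → Fin k → Fin 2
    bit = finToFun

  -- The bits of t are the characteristic function of a subset of Fin k.
  elements : Fin (2 ^ k) → List (Fin k)
  elements t = filter (λ i → bit t i ≟ suc zero) (allFin k)

  private
    ∈-elements : ∀ t i → i ∈ elements t ⇔ bit t i ≡ suc zero
    ∈-elements t i = mk⇔ (proj₂ ∘ ∈-filter⁻ bit? {xs = allFin k})
                         (∈-filter⁺ bit? (∈-allFin i))
      where bit? = λ j → bit t j ≟ suc zero

  elements-injective : ∀ {s t} →
    (∀ {i} → i ∈ elements s → i ∈ elements t) →
    (∀ {i} → i ∈ elements t → i ∈ elements s) → s ≡ t
  elements-injective {s} {t} s⊆t t⊆s =
    trans (sym (funToFin-finToFin {k} {2} s))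
      (trans (funToFin-cong bits) (funToFin-finToFin {k} {2} t))
    where
    bits : bit s ≗ bit t
    bits i = Fin2-ext (to (∈-elements t i) ∘ s⊆t ∘ from (∈-elements s i))
                      (to (∈-elements s i) ∘ t⊆s ∘ from (∈-elements t i))

-- Joining pointed models under a new root.

-- The disjoint union of a family of pointed models, with a new root (at which
-- p holds) that sees exactly the distinguished points.
module _ {ℓ} {I : Set} (e : I → PointedModel ℓ) where

  private
    module E i = Model (PointedModel.model (e i))

    Node : Set ℓ
    Node = Maybe (∃ E.dom)

    data Edge : Rel Node ℓ where
      new : ∀ i → Edge nothing (just (i , PointedModel.point (e i)))
      old : ∀ {i x y} → E.R i x y → Edge (just (i , x)) (just (i , y))

    joined : Model ℓ
    joined = record
      { dom = Node
      ; R   = Edge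
      ; v   = λ { nothing _ → ⊤ ; (just (i , x)) → E.v i x }
      }

    -- Edges never leave a component, so each component is a generated submodel of the joined model.
    inside : ∀ φ {i x} → joined , just (i , x) ⊨ φ ⇔ PointedModel.model (e i) , x ⊨ φ
    inside (var _) = mk⇔ (λ h → h) (λ h → h)
    inside (□ φ)   = mk⇔ (λ h y r → to (inside φ) (h _ (old r)))
                         (λ { h _ (old r) → from (inside φ) (h _ r) })
    inside (◇ φ)   = mk⇔ (λ { (_ , old r , h) → _ , r , to (inside φ) h })
                         (λ { (_ , r , h) → _ , old r , from (inside φ) h })
    inside (φ ∧ ψ) = mk⇔ (λ { (h , k) → to (inside φ) h , to (inside ψ) k })
                         (λ { (h , k) → from (inside φ) h , from (inside ψ) k })
    inside (φ ∨ ψ) = mk⇔ (λ { (inj₁ h) → inj₁ (to (inside φ) h)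
                            ; (inj₂ k) → inj₂ (to (inside ψ) k) })
                         (λ { (inj₁ h) → inj₁ (from (inside φ) h)
                            ; (inj₂ k) → inj₂ (from (inside ψ) k) })

  root : PointedModel ℓ
  root = joined at nothing

  root-□ : ∀ φ → root ⊩ □ φ ⇔ (∀ i → e i ⊩ φ)
  root-□ φ = mk⇔ (λ h i → to (inside φ) (h _ (new i)))
                 (λ { h _ (new i) → from (inside φ) (h i) })

  root-◇ : ∀ φ → root ⊩ ◇ φ ⇔ (∃[ i ] e i ⊩ φ)
  root-◇ φ = mk⇔ (λ { (_ , new i , h) → i , to (inside φ) h })
                 (λ { (i , h) → _ , new i , from (inside φ) h })

-- Covering families and the exponential step.

-- `covers` puts the condition on pairwise disjunctions contrapositively; in this form it directly
-- shows that distinct indices need distinct refuting examples.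
record CoveringFamily (ℓ : Level) (φ : Formula) (k : ℕ) : Set (lsuc ℓ) where
  field
    formula : Fin k → Formula
    below   : ∀ i (e : PointedModel ℓ) → e ⊩ formula i → e ⊩ φ
    covers  : ∀ (e : PointedModel ℓ) {i j} → e ⊩ φ →
              ¬ (e ⊩ formula i) → ¬ (e ⊩ formula j) → i ≡ j
    strict  : ∀ i → ∃[ e ] (_⊩_ {ℓ} e φ × ¬ (e ⊩ formula i))

-- A root without successors satisfies `p` and refutes `◇ p`; with a single index, `covers` is
-- immediate.
p-family : ∀ {ℓ} → CoveringFamily ℓ (var p) 1
p-family {ℓ} = record
  { formula = λ _ → var p ∧ ◇ var p
  ; below   = λ _ _ → proj₁
  ; covers  = λ { _ {zero} {zero} _ _ _ → refl }
  ; strict  = λ _ → root deadEnd , _ , λ { (_ , h) → proj₁ (to (root-◇ deadEnd (var p)) h) }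
  }
  where
  deadEnd : ⊥ → PointedModel ℓ
  deadEnd ()

module _ {ℓ} (em : ExcludedMiddle ℓ) where

  □-family : ∀ {φ k} → CoveringFamily ℓ φ k → CoveringFamily ℓ (□ φ) (2 ^ k)
  □-family {φ} {k} F = record
    { formula = λ t → □ φ ∧ escape t
    ; below   = λ _ _ → proj₁
    ; covers  = λ e {s} {t} h ¬s ¬t → elements-injective k
        (subset e s t h (¬s ∘ (h ,_)) (¬t ∘ (h ,_)))
        (subset e t s h (¬t ∘ (h ,_)) (¬s ∘ (h ,_)))
    ; strict  = λ t → root (refuter t) ,
        from (root-□ (refuter t) φ) (λ i → proj₁ (proj₂ (strict (proj₁ i)))) ,
        root-refutes t ∘ proj₂
    }
    where
    open CoveringFamily F

    els : Fin (2 ^ k) → List (Fin k)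
    els = elements k

    -- If `els t` is empty, `escape t` is just `◇ φ`, which a root without successors refutes.
    common escape : Fin (2 ^ k) → Formula
    common t = ⋀ φ formula (els t)
    escape t = ⋁ (◇ common t) (λ i → □ formula i) (els t)

    -- As `□ formula i` fails, some successor refutes `formula i`. As `◇ common t` fails, that
    -- successor also refutes `formula j` for some `j` in `els t`, and `covers` forces `j ≡ i`.
    subset : ∀ e s t {i} → e ⊩ □ φ → ¬ (e ⊩ escape s) → ¬ (e ⊩ escape t) →
             i ∈ els s → i ∈ els t
    subset e@(M at _) s t {i} □φ ¬s ¬t i∈s = decidable-stable (_∈?_ _≟_ i (els t)) λ i∉t →
      ¬s (⋁⁺ e (els s) (inj₁ (lose i∈s λ y r → decidable-stable em λ ¬ψi →
        ¬t (⋁⁺ e (els t) (inj₂ (y , r , ⋀⁺ (M at y) (□φ y r)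
          (All.tabulate λ {j} j∈t → decidable-stable em λ ¬ψj →
            i∉t (subst (_∈ els t) (covers (M at y) (□φ y r) ¬ψj ¬ψi) j∈t))))))))

    refuter : ∀ t → (∃[ i ] i ∈ els t) → PointedModel ℓ
    refuter t (i , _) = proj₁ (strict i)

    -- The successor labelled `i` refutes `formula i`. This defeats each disjunct `□ formula i`, and
    -- also `◇ common t`, since every successor carries a label from `els t`.
    root-refutes : ∀ t → ¬ (root (refuter t) ⊩ escape t)
    root-refutes t h with ⋁⁻ (root (refuter t)) (els t) h
    ... | inj₁ any with i , i∈t , □ψ ← find any =
      proj₂ (proj₂ (strict i)) (to (root-□ (refuter t) (formula i)) □ψ (i , i∈t))
    ... | inj₂ ◇⋀ with (i , i∈t) , h′ ← to (root-◇ (refuter t) (common t)) ◇⋀ =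
      proj₂ (proj₂ (strict i))
        (All.lookup (⋀⁻ (refuter t (i , i∈t)) {ψ = formula} (els t) h′) i∈t)

  tower-family : ∀ n → CoveringFamily ℓ (□^ (suc n) (var p)) (tower (suc n) 2)
  -- The base value 2 of the tower is `2 ^ 1`, from the one-element family.
  tower-family zero    = □-family p-family
  tower-family (suc n) = □-family (tower-family n)

  family⇒positives : ∀ {φ k E⁺ E⁻} → CoveringFamily ℓ φ k →
                     FiniteCharacterisation φ E⁺ E⁻ → HasAtLeast k E⁺
  family⇒positives {φ} {k} {E⁺} {E⁻} F C = example , injective , proj₁ ∘ proj₂ ∘ refuted
    where
    open CoveringFamily F
    open FiniteCharacterisation C

    ¬all : ∀ i → ¬ All (_⊩ formula i) E⁺
    ¬all i all with e , φ✓ , ψ✗ ← strict i =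
      -- Being below `φ`, `formula i` is false at all negative examples, so uniqueness would make it
      -- equivalent to `φ`, against `strict`.
      ψ✗ (from (unique (formula i) (all , All.map (λ ¬φ → ¬φ ∘ below i _) (proj₂ fits)) e) φ✓)

    refuted : ∀ i → ∃[ e ] (e ∈ E⁺ × ¬ (e ⊩ formula i))
    refuted i = find (All.¬All⇒Any¬ (λ _ → em) E⁺ (¬all i))

    example : Fin k → PointedModel ℓ
    example = proj₁ ∘ refuted

    injective : ∀ {i j} → example i ≡ example j → i ≡ j
    injective {i} {j} eq with refuted i | refuted j
    injective refl | e , e∈ , ¬i | _ , _ , ¬j = covers e (All.lookup (proj₁ fits) e∈) ¬i ¬j

-- Duality and complemented valuations.

dual : Formula → Formula
dual (var x) = var x
dual (□ φ)   = ◇ dual φ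
dual (◇ φ)   = □ dual φ
dual (φ ∧ ψ) = dual φ ∨ dual ψ
dual (φ ∨ ψ) = dual φ ∧ dual ψ

dual-involutive : ∀ φ → dual (dual φ) ≡ φ
dual-involutive (var x) = refl
dual-involutive (□ φ)   = cong □_ (dual-involutive φ)
dual-involutive (◇ φ)   = cong ◇_ (dual-involutive φ)
dual-involutive (φ ∧ ψ) = cong₂ _∧_ (dual-involutive φ) (dual-involutive ψ)
dual-involutive (φ ∨ ψ) = cong₂ _∨_ (dual-involutive φ) (dual-involutive ψ)

dual-◇^ : ∀ n → dual (◇^ n (var p)) ≡ □^ n (var p)
dual-◇^ zero    = refl
dual-◇^ (suc n) = cong □_ (dual-◇^ n)

complement : ∀ {ℓ} → PointedModel ℓ → PointedModel ℓ
complement (M at s) = record { dom = dom ; R = R ; v = λ t x → ¬ v t x } at s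
  where open Model M

module _ {ℓ} (em : ExcludedMiddle ℓ) where

  -- Induction by De Morgan's laws; excluded middle extracts a successor from a failed `□` and a
  -- disjunct from a failed `∧`.
  complement-dual : ∀ (e : PointedModel ℓ) φ → complement e ⊩ dual φ ⇔ (¬ (e ⊩ φ))
  complement-dual _        (var x) = mk⇔ (λ h → h) (λ h → h)
  complement-dual (M at s) (□ φ)   = mk⇔
    (λ { (t , r , h) □φ → to (complement-dual (M at t) φ) h (□φ t r) })
    (λ ¬□ → decidable-stable em λ ¬◇ → ¬□ λ t r → decidable-stable em λ ¬φ →
      ¬◇ (t , r , from (complement-dual (M at t) φ) ¬φ))
  complement-dual (M at s) (◇ φ)   = mk⇔
    (λ { h (t , r , k) → to (complement-dual (M at t) φ) (h t r) k })
    (λ ¬◇ t r → from (complement-dual (M at t) φ) (λ k → ¬◇ (t , r , k)))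
  complement-dual e        (φ ∧ ψ) = mk⇔
    (λ { (inj₁ h) → to (complement-dual e φ) h ∘ proj₁
       ; (inj₂ h) → to (complement-dual e ψ) h ∘ proj₂ })
    (λ ¬∧ → decidable-stable em λ ¬∨ →
      ¬∨ (inj₁ (from (complement-dual e φ) λ h →
      ¬∨ (inj₂ (from (complement-dual e ψ) λ k → ¬∧ (h , k))))))
  complement-dual e        (φ ∨ ψ) = mk⇔
    (λ { (h , _) (inj₁ k) → to (complement-dual e φ) h k
       ; (_ , h) (inj₂ k) → to (complement-dual e ψ) h k })
    (λ ¬∨ → from (complement-dual e φ) (¬∨ ∘ inj₁) ,
            from (complement-dual e ψ) (¬∨ ∘ inj₂))

  -- The involution is taken on formulas, because complementing a model twice leaves doubly negated
  -- valuations.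
  complement-⊩ : ∀ (e : PointedModel ℓ) φ → complement e ⊩ φ ⇔ (¬ (e ⊩ dual φ))
  complement-⊩ e φ = subst (λ χ → complement e ⊩ χ ⇔ (¬ (e ⊩ dual φ)))
                           (dual-involutive φ) (complement-dual e (dual φ))

  dual-characterisation : ∀ {φ} {E⁺ E⁻ : List (PointedModel ℓ)} →
    FiniteCharacterisation φ E⁺ E⁻ →
    FiniteCharacterisation (dual φ) (map complement E⁻) (map complement E⁺)
  dual-characterisation {φ} C = record
    { fits   = All.map⁺ (All.map (λ {e} → from (complement-dual e φ)) (proj₂ fits))
             , All.map⁺ (All.map (λ {e} h k → to (complement-dual e φ) k h) (proj₁ fits))
    ; unique = λ ψ (pos , neg) e →
        let dual-fits = All.map (λ {e} ¬ψ → decidable-stable em (¬ψ ∘ from (complement-⊩ e ψ)))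
                                (All.map⁻ neg)
                      , All.map (λ {e} → to (complement-⊩ e ψ)) (All.map⁻ pos)
            -- At `complement e`, the truth values of `dual ψ` and `φ` negate those of `ψ` and
            -- `dual φ` at `e`.
            ψ⇔φ = unique (dual ψ) dual-fits (complement e)
        in mk⇔
          (λ h → decidable-stable em λ ¬k →
            to (complement-dual e ψ) (from ψ⇔φ (from (complement-⊩ e φ) ¬k)) h)
          (λ k → decidable-stable em λ ¬h →
            to (complement-⊩ e φ) (to ψ⇔φ (from (complement-dual e ψ) ¬h)) k)
    }
    where open FiniteCharacterisation C

-- Choosing one preimage per image keeps the count, as equal preimages have equal images.
HasAtLeast-map⁻ : ∀ {a b} {A : Set a} {B : Set b} (g : A → B) {k xs} →
                  HasAtLeast k (map g xs) → HasAtLeast k xs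
HasAtLeast-map⁻ g {k} {xs} (f , f-injective , f∈) =
  proj₁ ∘ preimage , injective , proj₁ ∘ proj₂ ∘ preimage
  where
  preimage : ∀ i → ∃[ x ] (x ∈ xs × f i ≡ g x)
  preimage i = ∈-map⁻ g (f∈ i)

  injective : ∀ {i j} → proj₁ (preimage i) ≡ proj₁ (preimage j) → i ≡ j
  injective {i} {j} eq = f-injective
    (trans (proj₂ (proj₂ (preimage i))) (trans (cong g eq) (sym (proj₂ (proj₂ (preimage j))))))

theorem5p2 : ∀ {ℓ} → ExcludedMiddle ℓ → (n : ℕ) → n ≥ 1 →
    ((E⁺ E⁻ : List (PointedModel ℓ)) →
    FiniteCharacterisation (□^ n (var p)) E⁺ E⁻ → HasAtLeast (tower n 2) E⁺)
    ×
    ((E⁺ E⁻ : List (PointedModel ℓ)) →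
    FiniteCharacterisation (◇^ n (var p)) E⁺ E⁻ → HasAtLeast (tower n 2) E⁻)
theorem5p2 em (suc n) _ =
    (λ _ _ → family⇒positives em (tower-family em n))
  , (λ E⁺ E⁻ C → HasAtLeast-map⁻ complement
      (family⇒positives em (tower-family em n)
        (subst (λ φ → FiniteCharacterisation φ (map complement E⁻) (map complement E⁺))
          (dual-◇^ (suc n)) (dual-characterisation em C))))
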